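{- Every rigidity circuit $C$ can be obtained inductively by applying combinatorial resultant operations starting from $K_4$ circuits. Precisely: for every rigidity circuit $C$ there is a finite rooted binary tree (every internal node has exactly two children) whose nodes are labeled by rigidity circuits, such that the root is labeled by $C$, every leaf is labeled by a complete graph on $4$ vertices, and for every internal node labeled $G$ with children labeled $G_1,G_2$ there is a common edge $e$ of $G_1$ and $G_2$ with $G=\operatorname{CRes}(G_1,G_2,e)$.
   Context: All graphs are finite and simple; subgraphs of a complete graph $K_N$ on labeled vertices. A graph $G=(V,E)$ is $(2,3)$-sparse if every subset $V'\subseteq V$ with $|V'|\ge 2$ spans at most $2|V'|-3$ edges of $G$. The $(2,3)$-sparse edge sets are the independent sets of a matroid on the edges of $K_N$ (the generic 2D rigidity matroid). A rigidity circuit is a graph without isolated vertices whose edge set is a circuit (minimal dependent set) of this matroid. The smallest example is $K_4$. Combinatorial resultant: for two distinct graphs $G_1=(V_1,E_1)$ and $G_2=(V_2,E_2)$ with a common edge $e\in E_1\cap E_2$, $\operatorname{CRes}(G_1,G_2,e)$ is the graph with vertex set $V_1\cup V_2$ and edge set $(E_1\cup E_2)\setminus\{e\}$. -}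

module Defs where

open import Data.Bool.Base using (_∧_)
open import Data.Fin.Base using (Fin)
open import Data.Fin.Properties using (_<?_)
open import Data.Fin.Subset
  using (Subset; _∈_; _⊆_; _⊂_; _∪_; _∩_; _-_; ∣_∣; ⊤; ⁅_⁆)
open import Data.Fin.Subset.Properties using (∈⊤; x∈p∪q⁻; x∈p∪q⁺; p─q⊆p)
open import Data.List.Base using (List; allFin; cartesianProduct; filter; length; lookup)
open import Data.Nat.Base using (ℕ; _*_; _∸_; _≤_)
open import Data.Product.Base using (∃-syntax; _×_; _,_; proj₁; proj₂)
open import Data.Sum.Base using (inj₁; inj₂; _⊎_; [_,_]′)
open import Data.Tree.Binary using (Tree; leaf; node)
open import Data.Tree.Binary.Relation.Unary.All using (All)
import Data.Unit.Base as Unit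
import Data.Vec.Base as Vec
open import Function.Base using (const)
open import Relation.Binary.PropositionalEquality using (_≡_; _≢_)
open import Relation.Nullary.Negation using (¬_)

module SubgraphsOfK (N : ℕ) where

  -- The edges of K_N are the pairs i < j, numbered by their position in
  -- this list; sets of edges are then subsets in the sense of Data.Fin.Subset.

  pairs : List (Fin N × Fin N)
  pairs = filter (λ (i , j) → i <? j) (cartesianProduct (allFin N) (allFin N))

  Edge : Set
  Edge = Fin (length pairs)

  EdgeSet : Set
  EdgeSet = Subset (length pairs)

  src tgt : Edge → Fin N
  src e = proj₁ (lookup pairs e)
  tgt e = proj₂ (lookup pairs e)

  complete : Subset N → EdgeSet
  complete V = Vec.tabulate λ e → Vec.lookup V (src e) ∧ Vec.lookup V (tgt e)

  -- The incidence condition is irrelevant, so that _≡_ on graphs is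
  -- equality of the vertex sets and of the edge sets.

  record Graph : Set where
    constructor mkGraph
    field
      vertices   : Subset N
      edges      : EdgeSet
      .incidence : ∀ {e} → e ∈ edges → src e ∈ vertices × tgt e ∈ vertices

  open Graph public using (vertices; edges)

  IsSparse : Graph → Set
  IsSparse G = (V′ : Subset N) → V′ ⊆ vertices G → 2 ≤ ∣ V′ ∣ →
    ∣ edges G ∩ complete V′ ∣ ≤ 2 * ∣ V′ ∣ ∸ 3

  spanning : EdgeSet → Graph
  spanning E = mkGraph ⊤ E λ _ → ∈⊤ , ∈⊤

  Independent : EdgeSet → Set
  Independent E = IsSparse (spanning E)

  IsCircuit : EdgeSet → Set
  IsCircuit E = ¬ Independent E × ((F : EdgeSet) → F ⊂ E → Independent F)

  NoIsolatedVertices : Graph → Set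
  NoIsolatedVertices G = ∀ v → v ∈ vertices G →
    ∃[ e ] e ∈ edges G × (src e ≡ v ⊎ tgt e ≡ v)

  IsRigidityCircuit : Graph → Set
  IsRigidityCircuit G = NoIsolatedVertices G × IsCircuit (edges G)

  IsK₄ : Graph → Set
  IsK₄ G = ∣ vertices G ∣ ≡ 4 × edges G ≡ complete (vertices G)

  CRes : Graph → Graph → Edge → Graph
  CRes (mkGraph V₁ E₁ inc₁) (mkGraph V₂ E₂ inc₂) e =
    mkGraph (V₁ ∪ V₂) ((E₁ ∪ E₂) - e) λ x∈ →
      [ (λ x∈E₁ → let s , t = inc₁ x∈E₁ in x∈p∪q⁺ (inj₁ s) , x∈p∪q⁺ (inj₁ t))
      , (λ x∈E₂ → let s , t = inc₂ x∈E₂ in x∈p∪q⁺ (inj₂ s) , x∈p∪q⁺ (inj₂ t))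
      ]′ (x∈p∪q⁻ E₁ E₂ (p─q⊆p (E₁ ∪ E₂) ⁅ e ⁆ x∈))

  IsCRes : Graph → Graph → Graph → Set
  IsCRes G G₁ G₂ =
    G₁ ≢ G₂ × ∃[ e ] e ∈ edges G₁ × e ∈ edges G₂ × G ≡ CRes G₁ G₂ e

  GraphTree : Set
  GraphTree = Tree Graph Graph

  root : GraphTree → Graph
  root (leaf G)     = G
  root (node _ G _) = G

  NodesAreResultants : GraphTree → Set
  NodesAreResultants (leaf _)       = Unit.⊤
  NodesAreResultants (node t₁ G t₂) =
    IsCRes G (root t₁) (root t₂) × NodesAreResultants t₁ × NodesAreResultants t₂

  IsResultantTree : GraphTree → Set
  IsResultantTree t =
      All IsRigidityCircuit IsRigidityCircuit t
    × All (const Unit.⊤) IsK₄ t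
    × NodesAreResultants t

{-# OPTIONS --safe #-}
module Submission where

-- A circuit C satisfies |C| + 2 = 2 |V(C)|, so it has a vertex v of degree 3.
-- Let W be v with its three neighbours.  If C contains all edges on W then C is
-- the K₄ on W.  Otherwise let e be a missing edge on W, necessarily not at v.
-- By counting, C - v + e contains a circuit A; A has too many edges to lie within
-- W, so take f ∈ A off W; again by counting, C - f + e contains a circuit B.
-- Minimality of C puts e in A and B, and makes (A ∪ B) - e, which is dependent
-- by circuit elimination, equal to C.  Now |A| < |C|, whereas B keeps the star of
-- v, hence W, and either |B| < |C| or B = C - f + e misses one edge of W less.
-- So the pair (|C|, number of edges missing on W) decreases lexicographically.

open import Data.Bool.Base using (Bool; true; false; _∧_; if_then_else_)
open import Data.Empty using (⊥-elim)
import Data.Fin.Base as Fin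
open import Data.Fin.Base using (Fin; zero; suc)
open import Data.Fin.Properties as Fin using (any?)
open import Data.Fin.Subset
open import Data.Fin.Subset.Properties
open import Data.List.Base as List using (List)
import Data.List.Membership.Propositional.Properties as List
open import Data.List.Relation.Unary.All as ListAll using ()
open import Data.List.Relation.Unary.AllPairs as AllPairs using ()
open import Data.List.Relation.Unary.Any as Any using ()
open import Data.List.Relation.Unary.Any.Properties using (lookup-index)
open import Data.List.Relation.Unary.Unique.Propositional using (Unique)
import Data.List.Relation.Unary.Unique.Propositional.Properties as Unique
open import Data.Nat.Base using (ℕ; zero; suc; _+_; _*_; _∸_; _≤_; _<_; z≤n; s≤s; s≤s⁻¹)
open import Data.Nat.Properties
open import Data.Nat.Tactic.RingSolver using (solve-∀)
open import Data.Product.Base using (∃-syntax; _×_; _,_; proj₁; proj₂)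
open import Data.Sum.Base using (_⊎_; inj₁; inj₂; map₂; [_,_]′)
open import Data.Tree.Binary using (leaf; node)
open import Data.Tree.Binary.Relation.Unary.All as All using ()
import Data.Vec.Base as Vec
open import Data.Vec.Base using ([]; _∷_; here; there)
import Data.Vec.Properties as Vec
open import Function.Base using (_∘_; id)
open import Level using (0ℓ)
open import Relation.Binary.Definitions using (tri<; tri≈; tri>)
open import Relation.Binary.PropositionalEquality
open import Relation.Nullary
open import Relation.Nullary.Decidable using (dec-true; _×-dec_; decidable-stable)
open import Relation.Unary using (Pred; Decidable)
open import Algebra.Properties.CommutativeMonoid.Sum +-0-commutativeMonoid
  using (sum; ∑-comm; sum-cong-≗)
open import Defs

-- Subsets of finite sets and their cardinalities.

lookup-injective : ∀ {A : Set} {xs : List A} → Unique xs →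
  ∀ {i j} → List.lookup xs i ≡ List.lookup xs j → i ≡ j
lookup-injective (x∉ AllPairs.∷ u) {zero}  {zero}  _  = refl
lookup-injective (x∉ AllPairs.∷ u) {zero}  {suc j} eq =
  ⊥-elim (ListAll.lookup x∉ (List.∈-lookup j) eq)
lookup-injective (x∉ AllPairs.∷ u) {suc i} {zero}  eq =
  ⊥-elim (ListAll.lookup x∉ (List.∈-lookup i) (sym eq))
lookup-injective (x∉ AllPairs.∷ u) {suc i} {suc j} eq = cong suc (lookup-injective u eq)

module _ {n : ℕ} where

  ∈-tabulate⁺ : ∀ {f : Fin n → Bool} {x} → f x ≡ true → x ∈ Vec.tabulate f
  ∈-tabulate⁺ {f} {x} eq = Vec.lookup⇒[]= x _ (trans (Vec.lookup∘tabulate f x) eq)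

  ∈-tabulate⁻ : ∀ {f : Fin n → Bool} {x} → x ∈ Vec.tabulate f → f x ≡ true
  ∈-tabulate⁻ {f} {x} x∈ = trans (sym (Vec.lookup∘tabulate f x)) (Vec.[]=⇒lookup x∈)

  ⟪_⟫ : ∀ {P : Pred (Fin n) 0ℓ} → Decidable P → Subset n
  ⟪ P? ⟫ = Vec.tabulate (does ∘ P?)

  ∈-⟪⟫⁺ : ∀ {P : Pred (Fin n) 0ℓ} (P? : Decidable P) {x} → P x → x ∈ ⟪ P? ⟫
  ∈-⟪⟫⁺ P? {x} px = ∈-tabulate⁺ (dec-true (P? x) px)

  ∈-⟪⟫⁻ : ∀ {P : Pred (Fin n) 0ℓ} (P? : Decidable P) {x} → x ∈ ⟪ P? ⟫ → P x
  ∈-⟪⟫⁻ P? {x} x∈ with P? x | ∈-tabulate⁻ {f = does ∘ P?} x∈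
  ... | yes px | _ = px
  ... | no  _  | ()

x∈p─q⇒x∉q : ∀ {n} (p q : Subset n) {x} → x ∈ p ─ q → x ∉ q
x∈p─q⇒x∉q (_ ∷ _) (outside ∷ _) here         ()
x∈p─q⇒x∉q (_ ∷ p) (outside ∷ q) (there x∈) (there x∈q) = x∈p─q⇒x∉q p q x∈ x∈q
x∈p─q⇒x∉q (_ ∷ p) (inside  ∷ q) (there x∈) (there x∈q) = x∈p─q⇒x∉q p q x∈ x∈q

x∈p-y⇒x≢y : ∀ {n} (p : Subset n) {x y} → x ∈ p - y → x ≢ y
x∈p-y⇒x≢y p {x} x∈ refl = x∈p─q⇒x∉q p ⁅ x ⁆ x∈ (x∈⁅x⁆ x)

∣p∪q∣+∣p∩q∣ : ∀ {n} (p q : Subset n) → ∣ p ∪ q ∣ + ∣ p ∩ q ∣ ≡ ∣ p ∣ + ∣ q ∣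
∣p∪q∣+∣p∩q∣ []            []            = refl
∣p∪q∣+∣p∩q∣ (outside ∷ p) (outside ∷ q) = ∣p∪q∣+∣p∩q∣ p q
∣p∪q∣+∣p∩q∣ (inside  ∷ p) (outside ∷ q) = cong suc (∣p∪q∣+∣p∩q∣ p q)
∣p∪q∣+∣p∩q∣ (outside ∷ p) (inside  ∷ q) =
  trans (cong suc (∣p∪q∣+∣p∩q∣ p q)) (sym (+-suc _ _))
∣p∪q∣+∣p∩q∣ (inside  ∷ p) (inside  ∷ q) = cong suc
  (trans (+-suc _ _) (trans (cong suc (∣p∪q∣+∣p∩q∣ p q)) (sym (+-suc _ _))))

∣p─q∣+∣p∩q∣ : ∀ {n} (p q : Subset n) → ∣ p ─ q ∣ + ∣ p ∩ q ∣ ≡ ∣ p ∣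
∣p─q∣+∣p∩q∣ []            []            = refl
∣p─q∣+∣p∩q∣ (outside ∷ p) (outside ∷ q) = ∣p─q∣+∣p∩q∣ p q
∣p─q∣+∣p∩q∣ (inside  ∷ p) (outside ∷ q) = cong suc (∣p─q∣+∣p∩q∣ p q)
∣p─q∣+∣p∩q∣ (outside ∷ p) (inside  ∷ q) = ∣p─q∣+∣p∩q∣ p q
∣p─q∣+∣p∩q∣ (inside  ∷ p) (inside  ∷ q) = trans (+-suc _ _) (cong suc (∣p─q∣+∣p∩q∣ p q))

suc∣p-x∣≡∣p∣ : ∀ {n} {p : Subset n} {x} → x ∈ p → suc ∣ p - x ∣ ≡ ∣ p ∣
suc∣p-x∣≡∣p∣ {p = p} {x} x∈p = begin
  suc ∣ p - x ∣               ≡⟨ +-comm 1 _ ⟩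
  ∣ p - x ∣ + 1               ≡⟨ cong (∣ p - x ∣ +_) (sym (∣⁅x⁆∣≡1 x)) ⟩
  ∣ p - x ∣ + ∣ ⁅ x ⁆ ∣       ≡⟨ cong (λ q → ∣ p - x ∣ + ∣ q ∣) (sym p∩x≡x) ⟩
  ∣ p - x ∣ + ∣ p ∩ ⁅ x ⁆ ∣   ≡⟨ ∣p─q∣+∣p∩q∣ p ⁅ x ⁆ ⟩
  ∣ p ∣                       ∎
  where
  open ≡-Reasoning
  p∩x≡x : p ∩ ⁅ x ⁆ ≡ ⁅ x ⁆
  p∩x≡x = ⊆-antisym (p∩q⊆q p ⁅ x ⁆)
    λ y∈ → x∈p∩q⁺ (subst (_∈ p) (sym (x∈⁅y⁆⇒x≡y x y∈)) x∈p , y∈)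

∣p∪⁅x⁆∣≡suc∣p∣ : ∀ {n} {p : Subset n} {x} → x ∉ p → ∣ p ∪ ⁅ x ⁆ ∣ ≡ suc ∣ p ∣
∣p∪⁅x⁆∣≡suc∣p∣ {n} {p} {x} x∉p = begin
  ∣ p ∪ ⁅ x ⁆ ∣                   ≡⟨ sym (+-identityʳ _) ⟩
  ∣ p ∪ ⁅ x ⁆ ∣ + 0               ≡⟨ cong (∣ p ∪ ⁅ x ⁆ ∣ +_) (sym (∣⊥∣≡0 n)) ⟩
  ∣ p ∪ ⁅ x ⁆ ∣ + ∣ ⊥ {n} ∣       ≡⟨ cong (λ q → ∣ p ∪ ⁅ x ⁆ ∣ + ∣ q ∣) (sym p∩x≡⊥) ⟩
  ∣ p ∪ ⁅ x ⁆ ∣ + ∣ p ∩ ⁅ x ⁆ ∣   ≡⟨ ∣p∪q∣+∣p∩q∣ p ⁅ x ⁆ ⟩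
  ∣ p ∣ + ∣ ⁅ x ⁆ ∣               ≡⟨ cong (∣ p ∣ +_) (∣⁅x⁆∣≡1 x) ⟩
  ∣ p ∣ + 1                       ≡⟨ +-comm _ 1 ⟩
  suc ∣ p ∣                       ∎
  where
  open ≡-Reasoning
  p∩x≡⊥ : p ∩ ⁅ x ⁆ ≡ ⊥
  p∩x≡⊥ = Empty-unique λ (y , y∈) → let y∈p , y∈x = x∈p∩q⁻ p _ y∈ in
    x∉p (subst (_∈ p) (x∈⁅y⁆⇒x≡y x y∈x) y∈p)

0<∣p∣⇒Nonempty : ∀ {n} (p : Subset n) → 0 < ∣ p ∣ → Nonempty p
0<∣p∣⇒Nonempty (inside  ∷ p) _  = zero , here
0<∣p∣⇒Nonempty (outside ∷ p) lt = let x , x∈p = 0<∣p∣⇒Nonempty p lt in suc x , there x∈p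

p⊆q∧∣q∣≤∣p∣⇒q⊆p : ∀ {n} {p q : Subset n} → p ⊆ q → ∣ q ∣ ≤ ∣ p ∣ → q ⊆ p
p⊆q∧∣q∣≤∣p∣⇒q⊆p {p = p} p⊆q q≤p {x} x∈q = decidable-stable (x ∈? p) λ x∉p →
  <⇒≱ (p⊂q⇒∣p∣<∣q∣ (p⊆q , x , x∈q , x∉p)) q≤p

-- The relation stands in for an injection: each `i` picks some related `j`, and the second
-- hypothesis keeps the picks apart. The induction deletes each picked `j` from `q`. This suits
-- incidence relations, where no function need be named.
∣∣-mono-rel : ∀ {m n} (p : Subset m) (q : Subset n) (R : Fin m → Fin n → Set) →
  (∀ {i} → i ∈ p → ∃[ j ] j ∈ q × R i j) →
  (∀ {i i′ j} → i ∈ p → i′ ∈ p → R i j → R i′ j → i ≡ i′) →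
  ∣ p ∣ ≤ ∣ q ∣
∣∣-mono-rel []            q R tot inj = z≤n
∣∣-mono-rel (outside ∷ p) q R tot inj = ∣∣-mono-rel p q (R ∘ suc) (tot ∘ there)
  λ i∈ i′∈ r r′ → Fin.suc-injective (inj (there i∈) (there i′∈) r r′)
∣∣-mono-rel (inside  ∷ p) q R tot inj with tot here
... | j , j∈q , r₀ = subst (suc ∣ p ∣ ≤_) (suc∣p-x∣≡∣p∣ j∈q) (s≤s
  (∣∣-mono-rel p (q - j) (R ∘ suc) avoiding
    λ i∈ i′∈ r r′ → Fin.suc-injective (inj (there i∈) (there i′∈) r r′)))
  where
  avoiding : ∀ {i} → i ∈ p → ∃[ j′ ] j′ ∈ q - j × R (suc i) j′
  avoiding i∈p with tot (there i∈p)
  ... | j′ , j′∈q , r = j′ , x∈p∧x≢y⇒x∈p-y j′∈q distinct , r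
    where
    -- A later index picking `j` again would have to be the first index.
    distinct : j′ ≢ j
    distinct refl with inj (there i∈p) here r r₀
    ... | ()

-- Sums over finite index sets and double counting.

sum-lower : ∀ {n} (p : Subset n) (f : Fin n → ℕ) k →
  (∀ {i} → i ∈ p → k ≤ f i) → ∣ p ∣ * k ≤ sum f
sum-lower []            f k k≤f = z≤n
sum-lower (inside  ∷ p) f k k≤f = +-mono-≤ (k≤f here) (sum-lower p (f ∘ suc) k (k≤f ∘ there))
sum-lower (outside ∷ p) f k k≤f =
  ≤-trans (sum-lower p (f ∘ suc) k (k≤f ∘ there)) (m≤n+m _ (f zero))

sum-upper : ∀ {n} (p : Subset n) (f : Fin n → ℕ) k →
  (∀ {i} → i ∈ p → f i ≤ k) → (∀ {i} → i ∉ p → f i ≡ 0) → sum f ≤ ∣ p ∣ * k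
sum-upper []            f k f≤k f≡0 = z≤n
sum-upper (inside  ∷ p) f k f≤k f≡0 = +-mono-≤ (f≤k here)
  (sum-upper p (f ∘ suc) k (f≤k ∘ there) λ i∉ → f≡0 λ { (there i∈) → i∉ i∈ })
sum-upper (outside ∷ p) f k f≤k f≡0 rewrite f≡0 {zero} (λ ()) =
  sum-upper p (f ∘ suc) k (f≤k ∘ there) λ i∉ → f≡0 λ { (there i∈) → i∉ i∈ }

indicator : ∀ {n} → Subset n → Fin n → ℕ
indicator p x = if Vec.lookup p x then 1 else 0

∣p∣≡sum-indicator : ∀ {n} (p : Subset n) → ∣ p ∣ ≡ sum (indicator p)
∣p∣≡sum-indicator []            = refl
∣p∣≡sum-indicator (inside  ∷ p) = cong suc (∣p∣≡sum-indicator p)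
∣p∣≡sum-indicator (outside ∷ p) = ∣p∣≡sum-indicator p

-- Both sides count the true entries of one Boolean matrix, by rows and by columns.
double-counting : ∀ {m n} (R : Fin m → Subset n) (Rᵀ : Fin n → Subset m) →
  (∀ i j → Vec.lookup (R i) j ≡ Vec.lookup (Rᵀ j) i) →
  sum (λ i → ∣ R i ∣) ≡ sum (λ j → ∣ Rᵀ j ∣)
double-counting R Rᵀ eq = begin
  sum (λ i → ∣ R i ∣)                      ≡⟨ sum-cong-≗ (λ i → ∣p∣≡sum-indicator (R i)) ⟩
  sum (λ i → sum (indicator (R i)))        ≡⟨ ∑-comm (λ i → indicator (R i)) ⟩
  sum (λ j → sum (λ i → indicator (R i) j))
    ≡⟨ sum-cong-≗ (λ j → sum-cong-≗ (λ i → cong (if_then 1 else 0) (eq i j))) ⟩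
  sum (λ j → sum (indicator (Rᵀ j)))       ≡⟨ sum-cong-≗ (λ j → sym (∣p∣≡sum-indicator (Rᵀ j))) ⟩
  sum (λ j → ∣ Rᵀ j ∣)                     ∎
  where open ≡-Reasoning

module RigidityCircuits (N : ℕ) where

  open SubgraphsOfK N

  -- Edges of the complete graph and their endpoints.

  pairs-unique : Unique pairs
  pairs-unique = Unique.filter⁺ _
    (Unique.cartesianProduct⁺ (Unique.allFin⁺ N) (Unique.allFin⁺ N))

  src<tgt : ∀ e → src e Fin.< tgt e
  src<tgt e = proj₂ (List.∈-filter⁻ (λ (i , j) → i Fin.<? j)
    {xs = List.cartesianProduct (List.allFin N) (List.allFin N)} (List.∈-lookup e))

  src≢tgt : ∀ {e} → src e ≢ tgt e
  src≢tgt {e} = Fin.<⇒≢ (src<tgt e)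

  opaque
    ends : Edge → Subset N
    ends e = ⁅ src e ⁆ ∪ ⁅ tgt e ⁆

    src∈ends : ∀ {e} → src e ∈ ends e
    src∈ends {e} = x∈p∪q⁺ (inj₁ (x∈⁅x⁆ (src e)))

    tgt∈ends : ∀ {e} → tgt e ∈ ends e
    tgt∈ends {e} = x∈p∪q⁺ (inj₂ (x∈⁅x⁆ (tgt e)))

    ∈ends⁻ : ∀ {e v} → v ∈ ends e → v ≡ src e ⊎ v ≡ tgt e
    ∈ends⁻ {e} v∈ with x∈p∪q⁻ ⁅ src e ⁆ ⁅ tgt e ⁆ v∈
    ... | inj₁ v∈s = inj₁ (x∈⁅y⁆⇒x≡y _ v∈s)
    ... | inj₂ v∈t = inj₂ (x∈⁅y⁆⇒x≡y _ v∈t)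

    ∣ends∣≡2 : ∀ e → ∣ ends e ∣ ≡ 2
    ∣ends∣≡2 e = trans (∣p∪⁅x⁆∣≡suc∣p∣ (λ t∈ → src≢tgt (sym (x∈⁅y⁆⇒x≡y _ t∈))))
      (cong suc (∣⁅x⁆∣≡1 (src e)))

  other-end : ∀ {e v} → v ∈ ends e → ∃[ u ] u ∈ ends e × u ≢ v
  other-end {e} v∈ with ∈ends⁻ v∈
  ... | inj₁ refl = tgt e , tgt∈ends , src≢tgt ∘ sym
  ... | inj₂ refl = src e , src∈ends , src≢tgt

  other-end-unique : ∀ {e u w v} → v ∈ ends e → u ∈ ends e → w ∈ ends e →
    u ≢ v → w ≢ v → u ≡ w
  other-end-unique v∈ u∈ w∈ u≢v w≢v with ∈ends⁻ v∈ | ∈ends⁻ u∈ | ∈ends⁻ w∈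
  ... | inj₁ p | inj₁ q | _      = ⊥-elim (u≢v (trans q (sym p)))
  ... | inj₁ p | inj₂ q | inj₁ r = ⊥-elim (w≢v (trans r (sym p)))
  ... | inj₁ p | inj₂ q | inj₂ r = trans q (sym r)
  ... | inj₂ p | inj₂ q | _      = ⊥-elim (u≢v (trans q (sym p)))
  ... | inj₂ p | inj₁ q | inj₂ r = ⊥-elim (w≢v (trans r (sym p)))
  ... | inj₂ p | inj₁ q | inj₁ r = trans q (sym r)

  -- Simplicity of the graph: `pairs` has no repetitions and lists each pair in increasing order
  -- only.
  edge-unique : ∀ {e e′ u v} → u ≢ v → u ∈ ends e → v ∈ ends e →
    u ∈ ends e′ → v ∈ ends e′ → e ≡ e′
  edge-unique {e} {e′} u≢v ue ve ue′ ve′ with ∈ends⁻ ue | ∈ends⁻ ve | ∈ends⁻ ue′ | ∈ends⁻ ve′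
  ... | inj₁ p | inj₁ q | _ | _ = ⊥-elim (u≢v (trans p (sym q)))
  ... | inj₂ p | inj₂ q | _ | _ = ⊥-elim (u≢v (trans p (sym q)))
  ... | _ | _ | inj₁ p | inj₁ q = ⊥-elim (u≢v (trans p (sym q)))
  ... | _ | _ | inj₂ p | inj₂ q = ⊥-elim (u≢v (trans p (sym q)))
  ... | inj₁ p | inj₂ q | inj₁ r | inj₂ s = lookup-injective pairs-unique
    (cong₂ _,_ (trans (sym p) r) (trans (sym q) s))
  ... | inj₂ p | inj₁ q | inj₂ r | inj₁ s = lookup-injective pairs-unique
    (cong₂ _,_ (trans (sym q) s) (trans (sym p) r))
  -- The two edges would list `u` and `v` in opposite orders, but both orders are increasing.
  ... | inj₁ refl | inj₂ refl | inj₂ r | inj₁ s =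
    ⊥-elim (Fin.<-asym (src<tgt e) (subst₂ Fin._<_ (sym s) (sym r) (src<tgt e′)))
  ... | inj₂ refl | inj₁ refl | inj₁ r | inj₂ s =
    ⊥-elim (Fin.<-asym (src<tgt e) (subst₂ Fin._<_ (sym r) (sym s) (src<tgt e′)))

  edge-between-< : ∀ {u v} → u Fin.< v → ∃[ e ] u ∈ ends e × v ∈ ends e
  edge-between-< {u} {v} u<v = Any.index uv∈ ,
    subst (_∈ ends e) (cong proj₁ (sym (lookup-index uv∈))) (src∈ends {e}) ,
    subst (_∈ ends e) (cong proj₂ (sym (lookup-index uv∈))) (tgt∈ends {e})
    where
    uv∈ = List.∈-filter⁺ (λ (i , j) → i Fin.<? j)
      (List.∈-cartesianProduct⁺ (List.∈-allFin u) (List.∈-allFin v)) u<v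
    e = Any.index uv∈

  edge-between : ∀ {u v} → u ≢ v → ∃[ e ] u ∈ ends e × v ∈ ends e
  edge-between {u} {v} u≢v with Fin.<-cmp u v
  ... | tri< u<v _ _ = edge-between-< u<v
  ... | tri≈ _ u≡v _ = ⊥-elim (u≢v u≡v)
  ... | tri> _ _ v<u = let e , v∈ , u∈ = edge-between-< v<u in e , u∈ , v∈

  -- Complete edge sets, stars, supports and degrees.

  ∈complete⁺ : ∀ {X e} → ends e ⊆ X → e ∈ complete X
  ∈complete⁺ ⊆X = ∈-tabulate⁺
    (cong₂ _∧_ (Vec.[]=⇒lookup (⊆X src∈ends)) (Vec.[]=⇒lookup (⊆X tgt∈ends)))

  ∈complete⁻ : ∀ {X e} → e ∈ complete X → ends e ⊆ X
  ∈complete⁻ {X} {e} e∈ v∈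
    with Vec.lookup X (src e) in s∈X | Vec.lookup X (tgt e) in t∈X
       | ∈-tabulate⁻ {f = λ e → Vec.lookup X (src e) ∧ Vec.lookup X (tgt e)} e∈ | ∈ends⁻ v∈
  ... | true | true | _ | inj₁ refl = Vec.lookup⇒[]= _ X s∈X
  ... | true | true | _ | inj₂ refl = Vec.lookup⇒[]= _ X t∈X

  complete-mono : ∀ {X Y} → X ⊆ Y → complete X ⊆ complete Y
  complete-mono X⊆Y e∈ = ∈complete⁺ (X⊆Y ∘ ∈complete⁻ e∈)

  opaque
    star : Fin N → EdgeSet
    star v = ⟪ (λ e → v ∈? ends e) ⟫

    ∈star⁺ : ∀ {v e} → v ∈ ends e → e ∈ star v
    ∈star⁺ {v} = ∈-⟪⟫⁺ λ e → v ∈? ends e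

    ∈star⁻ : ∀ {v e} → e ∈ star v → v ∈ ends e
    ∈star⁻ {v} = ∈-⟪⟫⁻ λ e → v ∈? ends e

    supp : EdgeSet → Subset N
    supp E = ⟪ (λ v → nonempty? (E ∩ star v)) ⟫

    ∈supp⁺ : ∀ {E e v} → e ∈ E → v ∈ ends e → v ∈ supp E
    ∈supp⁺ {E} {e} e∈E v∈e =
      ∈-⟪⟫⁺ (λ v → nonempty? (E ∩ star v)) (e , x∈p∩q⁺ (e∈E , ∈star⁺ v∈e))

    ∈supp⁻ : ∀ {E v} → v ∈ supp E → ∃[ e ] e ∈ E × v ∈ ends e
    ∈supp⁻ {E} {v} v∈ with ∈-⟪⟫⁻ (λ v → nonempty? (E ∩ star v)) v∈
    ... | e , e∈ = let e∈E , e∈v = x∈p∩q⁻ E _ e∈ in e , e∈E , ∈star⁻ e∈v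

  degree : EdgeSet → Fin N → ℕ
  degree E v = ∣ E ∩ star v ∣

  supp-mono : ∀ {E F} → E ⊆ F → supp E ⊆ supp F
  supp-mono E⊆F v∈ = let e , e∈E , v∈e = ∈supp⁻ v∈ in ∈supp⁺ (E⊆F e∈E) v∈e

  ⊆complete-supp : ∀ {E} → E ⊆ complete (supp E)
  ⊆complete-supp e∈E = ∈complete⁺ (∈supp⁺ e∈E)

  supp⊆ : ∀ {E X} → E ⊆ complete X → supp E ⊆ X
  supp⊆ E⊆X v∈ = let e , e∈E , v∈e = ∈supp⁻ v∈ in ∈complete⁻ (E⊆X e∈E) v∈e

  2≤∣supp∣ : ∀ {E} → Nonempty E → 2 ≤ ∣ supp E ∣
  2≤∣supp∣ (e , e∈E) = subst (_≤ _) (∣ends∣≡2 e) (p⊆q⇒∣p∣≤∣q∣ (∈supp⁺ e∈E))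

  ─star⊆complete : ∀ {E X v} → E ⊆ complete X → E ─ star v ⊆ complete (X - v)
  ─star⊆complete {E} {X} {v} E⊆X e∈ = ∈complete⁺ {X - v} λ u∈e →
    x∈p∧x≢y⇒x∈p-y (∈complete⁻ {X} (E⊆X (p─q⊆p E (star v) e∈)) u∈e)
      λ { refl → x∈p─q⇒x∉q E (star v) e∈ (∈star⁺ u∈e) }

  opaque
    unfolding ends star

    -- The handshake lemma, by counting incidences: in the transposed incidence matrix each edge of
    -- `E` contributes its two ends and every other edge the empty set.
    degree-sum : ∀ E → sum (degree E) ≡ ∣ E ∣ * 2
    degree-sum E = trans (double-counting (λ v → E ∩ star v) endsIn transposed)
      (≤-antisym (sum-upper E _ 2 (≤-reflexive ∘ inE) notInE)
                 (sum-lower E _ 2 (≤-reflexive ∘ sym ∘ inE)))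
      where
      endsIn : Edge → Subset N
      endsIn e = if Vec.lookup E e then ends e else ⊥

      transposed : ∀ v e → Vec.lookup (E ∩ star v) e ≡ Vec.lookup (endsIn e) v
      transposed v e
        rewrite Vec.lookup-zipWith _∧_ e E (star v)
              | Vec.lookup∘tabulate (λ e → does (v ∈? ends e)) e
        with Vec.lookup E e
      ... | false = sym (Vec.lookup-replicate v false)
      ... | true with v ∈? ends e
      ...   | yes v∈ = sym (Vec.[]=⇒lookup v∈)
      ...   | no  v∉ with Vec.lookup (ends e) v in eq
      ...     | true  = ⊥-elim (v∉ (Vec.lookup⇒[]= v _ eq))
      ...     | false = refl

      inE : ∀ {e} → e ∈ E → ∣ endsIn e ∣ ≡ 2
      inE {e} e∈E rewrite Vec.[]=⇒lookup e∈E = ∣ends∣≡2 e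

      notInE : ∀ {e} → e ∉ E → ∣ endsIn e ∣ ≡ 0
      notInE {e} e∉E with Vec.lookup E e in eq
      ... | true  = ⊥-elim (e∉E (Vec.lookup⇒[]= e E eq))
      ... | false = ∣⊥∣≡0 N

  -- In a simple graph an edge at `v` and its other end determine each other, so the relation
  -- between them gives both inequalities.
  degree≡∣neighbours∣ : ∀ E v → degree E v ≡ ∣ supp (E ∩ star v) - v ∣
  degree≡∣neighbours∣ E v = ≤-antisym
    (∣∣-mono-rel S (supp S - v) (λ e u → u ∈ ends e × u ≢ v)
      (λ e∈S → let u , u∈e , u≢v = other-end (v∈end e∈S) in
        u , x∈p∧x≢y⇒x∈p-y (∈supp⁺ e∈S u∈e) u≢v , u∈e , u≢v)
      (λ e∈S e′∈S (u∈e , u≢v) (u∈e′ , _) →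
        edge-unique u≢v u∈e (v∈end e∈S) u∈e′ (v∈end e′∈S)))
    (∣∣-mono-rel (supp S - v) S (λ u e → u ∈ ends e × v ∈ ends e)
      (λ u∈ → let e , e∈S , u∈e = ∈supp⁻ {S} (p─q⊆p _ _ u∈) in e , e∈S , u∈e , v∈end e∈S)
      (λ u∈ w∈ (u∈e , v∈e) (w∈e , _) →
        other-end-unique v∈e u∈e w∈e (x∈p-y⇒x≢y (supp S) u∈) (x∈p-y⇒x≢y (supp S) w∈)))
    where
    S = E ∩ star v
    v∈end : ∀ {e} → e ∈ S → v ∈ ends e
    v∈end e∈S = ∈star⁻ (proj₂ (x∈p∩q⁻ E _ e∈S))

  -- The support of the star is the closed neighbourhood of `v`; for degree 3 this yields the four
  -- vertices of `W`.
  ∣supp-star∣ : ∀ {E v} → v ∈ supp E → ∣ supp (E ∩ star v) ∣ ≡ suc (degree E v)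
  ∣supp-star∣ {E} {v} v∈ with ∈supp⁻ {E} v∈
  ... | e , e∈E , v∈e = trans (sym (suc∣p-x∣≡∣p∣ (∈supp⁺ (x∈p∩q⁺ (e∈E , ∈star⁺ v∈e)) v∈e)))
    (cong suc (sym (degree≡∣neighbours∣ E v)))

  degree-complete : ∀ {X v} → v ∈ X → degree (complete X) v ≡ ∣ X ∣ ∸ 1
  degree-complete {X} {v} v∈X = begin
    degree (complete X) v    ≡⟨ degree≡∣neighbours∣ (complete X) v ⟩
    ∣ supp S - v ∣           ≡⟨ cong ∣_∣ (⊆-antisym nbr⊆ ⊆nbr) ⟩
    suc ∣ X - v ∣ ∸ 1        ≡⟨ cong (_∸ 1) (suc∣p-x∣≡∣p∣ v∈X) ⟩
    ∣ X ∣ ∸ 1                ∎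
    where
    open ≡-Reasoning
    S = complete X ∩ star v

    nbr⊆ : supp S - v ⊆ X - v
    nbr⊆ u∈ = x∈p∧x≢y⇒x∈p-y (supp⊆ (p∩q⊆p (complete X) (star v)) (p─q⊆p (supp S) _ u∈))
      (x∈p-y⇒x≢y (supp S) u∈)

    ⊆nbr : X - v ⊆ supp S - v
    ⊆nbr u∈ with edge-between (x∈p-y⇒x≢y X u∈)
    ... | e , u∈e , v∈e = x∈p∧x≢y⇒x∈p-y
      (∈supp⁺ (x∈p∩q⁺ (∈complete⁺ e⊆X , ∈star⁺ v∈e)) u∈e) (x∈p-y⇒x≢y X u∈)
      where
      e⊆X : ends e ⊆ X
      e⊆X {w} w∈e with w Fin.≟ v
      ... | yes refl = v∈X
      ... | no  w≢v  = subst (_∈ X)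
        (other-end-unique v∈e u∈e w∈e (x∈p-y⇒x≢y X u∈) w≢v) (p─q⊆p X _ u∈)

  -- Handshake lemma for a clique; the doubled form avoids halving in the binomial coefficient.
  ∣complete∣*2 : ∀ X → ∣ complete X ∣ * 2 ≡ ∣ X ∣ * (∣ X ∣ ∸ 1)
  ∣complete∣*2 X = trans (sym (degree-sum (complete X))) (≤-antisym
    (sum-upper X _ _ (≤-reflexive ∘ degree-complete) noEdges)
    (sum-lower X _ _ (≤-reflexive ∘ sym ∘ degree-complete)))
    where
    noEdges : ∀ {v} → v ∉ X → degree (complete X) v ≡ 0
    noEdges {v} v∉X = trans
      (cong ∣_∣ (Empty-unique λ (e , e∈) → let e∈X , e∈v = x∈p∩q⁻ (complete X) _ e∈ in
        v∉X (∈complete⁻ e∈X (∈star⁻ e∈v))))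
      (∣⊥∣≡0 (List.length pairs))

  -- Sparsity, dependence and circuits of the rigidity matroid.

  -- Unlike Independent and IsCircuit, records let Agda infer the edge set.

  record Sparse (E : EdgeSet) : Set where
    field bound : ∀ X → 2 ≤ ∣ X ∣ → 3 + ∣ E ∩ complete X ∣ ≤ 2 * ∣ X ∣

  open Sparse

  record Circuit (C : EdgeSet) : Set where
    field
      dependent : ¬ Sparse C
      minimal   : ∀ {F} → F ⊂ C → Sparse F

  open Circuit

  -- The truncated subtraction loses nothing, because `2 ≤ ∣ X ∣` gives `3 ≤ 2 * ∣ X ∣`.
  independent⇒sparse : ∀ {E} → Independent E → Sparse E
  independent⇒sparse {E} ind .bound X 2≤X =
    subst (_≤ 2 * ∣ X ∣) (+-comm (∣ E ∩ complete X ∣) 3)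
    (m≤o∸n⇒m+n≤o (∣ E ∩ complete X ∣) (≤-trans (n≤1+n 3) (*-monoʳ-≤ 2 2≤X))
      (ind X (λ _ → ∈⊤) 2≤X))

  sparse⇒independent : ∀ {E} → Sparse E → Independent E
  sparse⇒independent {E} sp X _ 2≤X = m+n≤o⇒m≤o∸n (∣ E ∩ complete X ∣)
    (subst (_≤ 2 * ∣ X ∣) (+-comm 3 (∣ E ∩ complete X ∣)) (bound sp X 2≤X))

  isCircuit⇒circuit : ∀ {C} → IsCircuit C → Circuit C
  isCircuit⇒circuit (dep , min) = record
    { dependent = λ sp → dep (sparse⇒independent sp)
    ; minimal   = λ F⊂C → independent⇒sparse (min _ F⊂C)
    }

  circuit⇒isCircuit : ∀ {C} → Circuit C → IsCircuit C
  circuit⇒isCircuit c =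
    (λ ind → dependent c (independent⇒sparse ind)) ,
    (λ F F⊂C → sparse⇒independent (minimal c F⊂C))

  sparse-bound : ∀ {E} X → Sparse E → E ⊆ complete X → 2 ≤ ∣ X ∣ → 3 + ∣ E ∣ ≤ 2 * ∣ X ∣
  sparse-bound X sp E⊆X 2≤X =
    ≤-trans (+-monoʳ-≤ 3 (p⊆q⇒∣p∣≤∣q∣ λ e∈ → x∈p∩q⁺ (e∈ , E⊆X e∈))) (bound sp X 2≤X)

  overloaded⇒dependent : ∀ {E} X → E ⊆ complete X → 2 ≤ ∣ X ∣ → 2 * ∣ X ∣ ≤ 2 + ∣ E ∣ →
    ¬ Sparse E
  overloaded⇒dependent X E⊆X 2≤X X≤E ind =
    <-irrefl refl (≤-trans (sparse-bound X ind E⊆X 2≤X) X≤E)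

  -- A violation of the sparsity bound, put positively: at least `2 * ∣ X ∣ ∸ 2` edges on `X`. There
  -- are finitely many `X`, so a violation can be searched for.
  Overloaded : EdgeSet → Subset N → Set
  Overloaded E X = 2 ≤ ∣ X ∣ × 2 * ∣ X ∣ ≤ 2 + ∣ E ∩ complete X ∣

  overloaded? : ∀ E → Dec (∃[ X ] Overloaded E X)
  overloaded? E = anySubset? λ X →
    (2 ≤? ∣ X ∣) ×-dec (2 * ∣ X ∣ ≤? 2 + ∣ E ∩ complete X ∣)

  ¬overloaded⇒sparse : ∀ {E} → ¬ (∃[ X ] Overloaded E X) → Sparse E
  ¬overloaded⇒sparse ¬over .bound X 2≤X = ≰⇒> λ X≤E → ¬over (X , 2≤X , X≤E)

  dependent⇒overloaded : ∀ {E} → ¬ Sparse E → ∃[ X ] Overloaded E X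
  dependent⇒overloaded {E} dep =
    decidable-stable (overloaded? E) λ ¬over → dep (¬overloaded⇒sparse ¬over)

  overloaded-restriction : ∀ {E} X → Overloaded E X → ¬ Sparse (E ∩ complete X)
  overloaded-restriction {E} X (2≤X , X≤E) =
    overloaded⇒dependent X (p∩q⊆q E (complete X)) 2≤X X≤E

  sparse-⊆ : ∀ {E F} → E ⊆ F → Sparse F → Sparse E
  sparse-⊆ {E} E⊆F sp .bound X 2≤X = ≤-trans
    (+-monoʳ-≤ 3 (p⊆q⇒∣p∣≤∣q∣ λ e∈ →
      let e∈E , e∈X = x∈p∩q⁻ E _ e∈ in x∈p∩q⁺ (E⊆F e∈E , e∈X)))
    (bound sp X 2≤X)

  sparse? : ∀ E → Dec (Sparse E)
  sparse? E with overloaded? E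
  ... | yes (X , over) = no λ ind →
    overloaded-restriction X over (sparse-⊆ (p∩q⊆p E (complete X)) ind)
  ... | no  ¬over      = yes (¬overloaded⇒sparse ¬over)

  -- An edge of `C` outside `F` would make `F` a proper subset and hence sparse. Most equalities of
  -- edge sets below come from this form of minimality.
  circuit-⊆-dependent : ∀ {C F} → Circuit C → F ⊆ C → ¬ Sparse F → C ⊆ F
  circuit-⊆-dependent {F = F} circuit F⊆C dep {e} e∈C =
    decidable-stable (e ∈? F) λ e∉F → dep (minimal circuit (F⊆C , e , e∈C , e∉F))

  opaque
    -- Edges are deleted while dependence survives; `n` bounds the number of edges left.
    dependent⇒circuit : ∀ {E} → ¬ Sparse E → ∃[ C ] C ⊆ E × Circuit C
    dependent⇒circuit {E} dep = search ∣ E ∣ E ≤-refl dep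
      where
      search : ∀ n E → ∣ E ∣ ≤ n → ¬ Sparse E → ∃[ C ] C ⊆ E × Circuit C
      search n E E≤n dep
        with any? (λ e → (e ∈? E) ×-dec ¬? (sparse? (E - e)))
      ... | no  none = E , id , record
        { dependent = dep
        -- Testing single deletions suffices: a proper subset misses some `e`, so it lies in the
        -- sparse set `E - e`.
        ; minimal   = λ (F⊆E , e , e∈E , e∉F) →
            sparse-⊆ (λ x∈F → x∈p∧x≢y⇒x∈p-y (F⊆E x∈F) λ { refl → e∉F x∈F })
              (decidable-stable (sparse? (E - e)) λ dep-e → none (e , e∈E , dep-e))
        }
      search zero    E E≤0 dep | yes (e , e∈E , _) =
        ⊥-elim (n≮0 (≤-trans (≤-reflexive (suc∣p-x∣≡∣p∣ e∈E)) E≤0))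
      search (suc n) E E≤n dep | yes (e , e∈E , dep-e)
        with search n (E - e) (s≤s⁻¹ (≤-trans (≤-reflexive (suc∣p-x∣≡∣p∣ e∈E)) E≤n)) dep-e
      ... | C , C⊆ , circuit = C , p─q⊆p E ⁅ e ⁆ ∘ C⊆ , circuit

  -- Edge counts and vertex degrees of circuits.

  circuit-nonempty : ∀ {C} → Circuit C → Nonempty C
  circuit-nonempty {C} circuit with dependent⇒overloaded (dependent circuit)
  ... | X , 2≤X , X≤C = 0<∣p∣⇒Nonempty C (≤-trans
    (+-cancelˡ-≤ 2 1 _ (≤-trans (n≤1+n 3) (≤-trans (*-monoʳ-≤ 2 2≤X) X≤C)))
    (p⊆q⇒∣p∣≤∣q∣ (p∩q⊆p C (complete X))))

  -- Upper bound: deleting one edge leaves a sparse set on the same support. Lower bound: by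
  -- minimality an overloaded `X` spans all of `C`, so it contains `supp C`.
  circuit-tight : ∀ {C} → Circuit C → 2 + ∣ C ∣ ≡ 2 * ∣ supp C ∣
  circuit-tight {C} circuit = ≤-antisym upper lower
    where
    upper : 2 + ∣ C ∣ ≤ 2 * ∣ supp C ∣
    upper with circuit-nonempty circuit
    ... | e , e∈C = subst (λ k → 2 + k ≤ 2 * ∣ supp C ∣) (suc∣p-x∣≡∣p∣ e∈C)
      (sparse-bound (supp C) (minimal circuit (x∈p⇒p-x⊂p e∈C))
        (⊆complete-supp {C} ∘ p─q⊆p C ⁅ e ⁆) (2≤∣supp∣ (e , e∈C)))

    lower : 2 * ∣ supp C ∣ ≤ 2 + ∣ C ∣
    lower with dependent⇒overloaded (dependent circuit)
    ... | X , over@(_ , X≤C) = ≤-trans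
      (*-monoʳ-≤ 2 (p⊆q⇒∣p∣≤∣q∣ (supp⊆ {X = X} C⊆X)))
      (≤-trans X≤C (+-monoʳ-≤ 2 (p⊆q⇒∣p∣≤∣q∣ (p∩q⊆p C (complete X)))))
      where
      C⊆X : C ⊆ complete X
      C⊆X = p∩q⊆q C _ ∘ circuit-⊆-dependent circuit (p∩q⊆p C _) (overloaded-restriction X over)

  -- A tight circuit on 2 or 3 vertices would have 2 or 4 edges, whereas only 1 or 3 exist.
  4≤∣supp∣ : ∀ {C} → Circuit C → 4 ≤ ∣ supp C ∣
  4≤∣supp∣ {C} circuit = arith ∣ supp C ∣ (2≤∣supp∣ (circuit-nonempty circuit))
    (circuit-tight circuit)
    (subst (∣ C ∣ * 2 ≤_) (∣complete∣*2 (supp C)) (*-monoˡ-≤ 2 (p⊆q⇒∣p∣≤∣q∣ (⊆complete-supp {C}))))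
    where
    arith : ∀ n {c} → 2 ≤ n → 2 + c ≡ 2 * n → c * 2 ≤ n * (n ∸ 1) → 4 ≤ n
    arith 2 _ refl (s≤s (s≤s ()))
    arith 3 _ refl (s≤s (s≤s (s≤s (s≤s (s≤s (s≤s ()))))))
    arith 1 (s≤s ()) _ _
    arith (suc (suc (suc (suc n)))) _ _ _ = s≤s (s≤s (s≤s (s≤s z≤n)))

  6≤∣circuit∣ : ∀ {C} → Circuit C → 6 ≤ ∣ C ∣
  6≤∣circuit∣ circuit = +-cancelˡ-≤ 2 6 _
    (subst (8 ≤_) (sym (circuit-tight circuit)) (*-monoʳ-≤ 2 (4≤∣supp∣ circuit)))

  -- With `n` vertices in the support, removing the star leaves a sparse set on `n - 1` vertices, so
  -- at most `2n - 5` of the `2n - 2` edges remain.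
  3≤degree : ∀ {C v} → Circuit C → v ∈ supp C → 3 ≤ degree C v
  3≤degree {C} {v} circuit v∈ with ∈supp⁻ {C} v∈
  ... | e , e∈C , v∈e = arith (∣ D ∣) (degree C v) (∣ supp C - v ∣)
    (sparse-bound (supp C - v)
      (minimal circuit (p∩q≢∅⇒p─q⊂p C (star v) (e , x∈p∩q⁺ (e∈C , ∈star⁺ v∈e))))
      (─star⊆complete {C} {supp C} (⊆complete-supp {C}))
      (s≤s⁻¹ (≤-trans (≤-trans (n≤1+n 3) (4≤∣supp∣ circuit)) (≤-reflexive (sym remove)))))
    (trans (cong (2 +_) (∣p─q∣+∣p∩q∣ C (star v)))
      (trans (circuit-tight circuit) (cong (2 *_) (sym remove))))
    where
    D = C ─ star v
    remove : suc ∣ supp C - v ∣ ≡ ∣ supp C ∣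
    remove = suc∣p-x∣≡∣p∣ v∈
    arith : ∀ d k n → 3 + d ≤ 2 * n → 2 + (d + k) ≡ 2 * suc n → 3 ≤ k
    arith d k n 3+d≤2n eq = +-cancelˡ-≤ (2 + d) 3 k (begin
      2 + d + 3      ≡⟨ lhs d ⟩
      2 + (3 + d)    ≤⟨ +-monoʳ-≤ 2 3+d≤2n ⟩
      2 + 2 * n      ≡⟨ *-suc 2 n ⟨
      2 * suc n      ≡⟨ eq ⟨
      2 + (d + k)    ≡⟨⟩
      2 + d + k      ∎)
      where
      open ≤-Reasoning
      lhs : ∀ d → 2 + d + 3 ≡ 2 + (3 + d)
      lhs = solve-∀

  -- On `n` vertices the degrees sum to twice `2n - 2`, which is less than `4n`.
  ¬4≤degrees : ∀ {C} → Circuit C → ¬ (∀ {v} → v ∈ supp C → 4 ≤ degree C v)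
  ¬4≤degrees {C} circuit 4≤degree = arith (∣ C ∣) (∣ supp C ∣) (circuit-tight circuit)
    (subst (∣ supp C ∣ * 4 ≤_) (degree-sum C) (sum-lower (supp C) (degree C) 4 4≤degree))
    where
    arith : ∀ c n → 2 + c ≡ 2 * n → ¬ (n * 4 ≤ c * 2)
    arith c n 2+c≡2n 4n≤2c = <⇒≱ (s≤s (≤-trans (n≤1+n _) (≤-trans (n≤1+n _) (n≤1+n _))))
      (subst (_≤ c * 2) (trans (4n≡ n) (cong (_* 2) (sym 2+c≡2n))) 4n≤2c)
      where
      4n≡ : ∀ n → n * 4 ≡ 2 * n * 2
      4n≡ = solve-∀

  opaque
    degree-3-vertex : ∀ {C} → Circuit C → ∃[ v ] v ∈ supp C × degree C v ≡ 3
    degree-3-vertex {C} circuit =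
      decidable-stable (any? λ v → (v ∈? supp C) ×-dec (degree C v ≟ 3)) λ none →
        ¬4≤degrees circuit λ {v} v∈ →
          ≤∧≢⇒< (3≤degree circuit v∈) λ 3≡d → none (v , v∈ , sym 3≡d)

  -- `A ∩ B` is a proper subset of `A`, hence sparse, and it contains `e`, so `X ∩ Y` has two
  -- vertices and the sparsity bound applies to it. Inclusion-exclusion for edges and for vertices,
  -- with tightness of `A` and `B`, then overloads `X ∪ Y` even without `e`.
  circuit-elimination : ∀ {A B e} → Circuit A → Circuit B → ¬ (A ⊆ B) →
    e ∈ A → e ∈ B → ¬ Sparse ((A ∪ B) - e)
  circuit-elimination {A} {B} {e} cA cB A⊈B e∈A e∈B = overloaded⇒dependent (X ∪ Y) ⊆X∪Y
    (≤-trans (2≤∣supp∣ (e , e∈A)) (∣p∣≤∣p∪q∣ X Y))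
    (arith (∣ A ∣) (∣ B ∣) (∣ A ∩ B ∣) (∣ X ∣) (∣ Y ∣) (∣ X ∩ Y ∣)
      (trans (cong (_+ ∣ A ∩ B ∣) (suc∣p-x∣≡∣p∣ (x∈p∪q⁺ (inj₁ e∈A)))) (∣p∪q∣+∣p∩q∣ A B))
      (∣p∪q∣+∣p∩q∣ X Y) (circuit-tight cA) (circuit-tight cB) common-bound)
    where
    X = supp A
    Y = supp B

    ⊆X∪Y : (A ∪ B) - e ⊆ complete (X ∪ Y)
    ⊆X∪Y f∈ with x∈p∪q⁻ A B (p─q⊆p (A ∪ B) ⁅ e ⁆ f∈)
    ... | inj₁ f∈A = complete-mono (p⊆p∪q {p = X} Y) (⊆complete-supp {A} f∈A)
    ... | inj₂ f∈B = complete-mono (q⊆p∪q X Y) (⊆complete-supp {B} f∈B)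

    common-sparse : Sparse (A ∩ B)
    common-sparse = decidable-stable (sparse? (A ∩ B)) λ dep →
      A⊈B (p∩q⊆q A B ∘ circuit-⊆-dependent cA (p∩q⊆p A B) dep)

    ⊆X∩Y : A ∩ B ⊆ complete (X ∩ Y)
    ⊆X∩Y f∈ with x∈p∩q⁻ A B f∈
    ... | f∈A , f∈B = ∈complete⁺ {X ∩ Y} λ u∈f → x∈p∩q⁺ (∈supp⁺ f∈A u∈f , ∈supp⁺ f∈B u∈f)

    common-bound : 3 + ∣ A ∩ B ∣ ≤ 2 * ∣ X ∩ Y ∣
    common-bound = sparse-bound (X ∩ Y) common-sparse ⊆X∩Y
      (subst (_≤ ∣ X ∩ Y ∣) (∣ends∣≡2 e)
        (p⊆q⇒∣p∣≤∣q∣ (∈complete⁻ {X ∩ Y} (⊆X∩Y (x∈p∩q⁺ (e∈A , e∈B))))))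

    arith : ∀ a b c x y z {d w} → suc d + c ≡ a + b → w + z ≡ x + y →
      2 + a ≡ 2 * x → 2 + b ≡ 2 * y → 3 + c ≤ 2 * z → 2 * w ≤ 2 + d
    -- Adding `3 + c`, where `c` counts the common edges, to both sides keeps the computation free
    -- of subtraction.
    arith a b c x y z {d} {w} d+c w+z a≡x b≡y c≤z = +-cancelʳ-≤ (3 + c) _ _ (begin
      2 * w + (3 + c)        ≤⟨ +-monoʳ-≤ (2 * w) c≤z ⟩
      2 * w + 2 * z          ≡⟨ *-distribˡ-+ 2 w z ⟨
      2 * (w + z)            ≡⟨ cong (2 *_) w+z ⟩
      2 * (x + y)            ≡⟨ *-distribˡ-+ 2 x y ⟩
      2 * x + 2 * y          ≡⟨ cong₂ _+_ a≡x b≡y ⟨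
      (2 + a) + (2 + b)      ≡⟨ regroup a b ⟩
      4 + (a + b)            ≡⟨ cong (4 +_) d+c ⟨
      4 + (suc d + c)        ≡⟨ regroup′ d c ⟩
      (2 + d) + (3 + c)      ∎)
      where
      open ≤-Reasoning
      regroup : ∀ a b → (2 + a) + (2 + b) ≡ 4 + (a + b)
      regroup = solve-∀
      regroup′ : ∀ d c → 4 + (suc d + c) ≡ (2 + d) + (3 + c)
      regroup′ = solve-∀

  -- From edge sets back to graphs, and recognition of K₄.

  graph : EdgeSet → Graph
  graph E = mkGraph (supp E) E λ e∈E → ∈supp⁺ e∈E src∈ends , ∈supp⁺ e∈E tgt∈ends

  graph-≡ : ∀ {V V′ E E′}
    .{inc  : ∀ {e} → e ∈ E  → src e ∈ V  × tgt e ∈ V}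
    .{inc′ : ∀ {e} → e ∈ E′ → src e ∈ V′ × tgt e ∈ V′} →
    V ≡ V′ → E ≡ E′ → mkGraph V E inc ≡ mkGraph V′ E′ inc′
  graph-≡ refl refl = refl

  graph-edges : ∀ {G} → NoIsolatedVertices G → graph (edges G) ≡ G
  graph-edges {mkGraph V E inc} covered = graph-≡ (⊆-antisym supp⊆V V⊆supp) refl
    where
    supp⊆V : supp E ⊆ V
    supp⊆V {v} v∈ with ∈supp⁻ {E} v∈
    ... | e , e∈E , v∈e with ∈ends⁻ v∈e
    -- Incidence is irrelevant, but membership is decidable and can be recomputed.
    ...   | inj₁ refl = recompute (v ∈? V) (proj₁ (inc e∈E))
    ...   | inj₂ refl = recompute (v ∈? V) (proj₂ (inc e∈E))

    V⊆supp : V ⊆ supp E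
    V⊆supp {v} v∈V with covered v v∈V
    ... | e , e∈E , inj₁ refl = ∈supp⁺ e∈E src∈ends
    ... | e , e∈E , inj₂ refl = ∈supp⁺ e∈E tgt∈ends

  graph-rigidityCircuit : ∀ {C} → Circuit C → IsRigidityCircuit (graph C)
  graph-rigidityCircuit {C} circuit = covered , circuit⇒isCircuit circuit
    where
    covered : NoIsolatedVertices (graph C)
    covered v v∈ with ∈supp⁻ {C} v∈
    ... | e , e∈C , v∈e with ∈ends⁻ v∈e
    ...   | inj₁ v≡s = e , e∈C , inj₁ (sym v≡s)
    ...   | inj₂ v≡t = e , e∈C , inj₂ (sym v≡t)

  -- The complete graph on four vertices has 6 = 2 · 4 - 2 edges, so it is dependent, and a circuit
  -- containing it must equal it.
  circuit-K₄ : ∀ {C W} → Circuit C → ∣ W ∣ ≡ 4 → W ⊆ supp C → complete W ⊆ C →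
    IsK₄ (graph C)
  circuit-K₄ {C} {W} circuit ∣W∣≡4 W⊆C KW⊆C =
    subst (λ V → ∣ V ∣ ≡ 4 × C ≡ complete V) (⊆-antisym W⊆C (supp⊆ C⊆KW))
      (∣W∣≡4 , ⊆-antisym C⊆KW KW⊆C)
    where
    ∣KW∣≡6 : ∣ complete W ∣ ≡ 6
    ∣KW∣≡6 = *-cancelʳ-≡ _ 6 2 (trans (∣complete∣*2 W) (cong (λ n → n * (n ∸ 1)) ∣W∣≡4))

    C⊆KW : C ⊆ complete W
    C⊆KW = circuit-⊆-dependent circuit KW⊆C
      (overloaded⇒dependent W id (subst (2 ≤_) (sym ∣W∣≡4) (s≤s (s≤s z≤n)))
        (≤-reflexive (trans (cong (2 *_) ∣W∣≡4) (cong (2 +_) (sym ∣KW∣≡6)))))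

  -- Splitting a circuit at a vertex of degree 3.

  record Resolution (C : EdgeSet) (v : Fin N) : Set where
    field
      {A B}     : EdgeSet
      {e}       : Edge
      circuit-A : Circuit A
      circuit-B : Circuit B
      A≢B       : A ≢ B
      e∈A       : e ∈ A
      e∈B       : e ∈ B
      resultant : (A ∪ B) - e ≡ C
      e⊆C       : ends e ⊆ supp C
      smaller-A : ∣ A ∣ < ∣ C ∣
      -- This keeps `v` at degree 3 with the same neighbourhood in `B`, so the counts of missing
      -- edges of `B` and `C` refer to one vertex set.
      star-B    : B ∩ star v ≡ C ∩ star v
      smaller-B : ∣ B ∣ < ∣ C ∣ ⊎ ∣ B ∣ ≤ ∣ C ∣ ×
        ∣ complete (supp (C ∩ star v)) ─ B ∣ < ∣ complete (supp (C ∩ star v)) ─ C ∣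

  module Step {C v} (circuit : Circuit C) (v∈C : v ∈ supp C) (deg3 : degree C v ≡ 3)
    {e} (e∈KW : e ∈ complete (supp (C ∩ star v))) (e∉C : e ∉ C) where

    S = C ∩ star v
    W = supp S

    W⊆C : W ⊆ supp C
    W⊆C = supp-mono (p∩q⊆p C (star v))

    e⊆C : ends e ⊆ supp C
    e⊆C = W⊆C ∘ ∈complete⁻ {W} e∈KW

    ∣W-v∣≡3 : ∣ W - v ∣ ≡ 3
    ∣W-v∣≡3 = trans (sym (degree≡∣neighbours∣ C v)) deg3

    -- If `v` were an end of `e`, the other end would be a neighbour of `v` in `C`; by simplicity
    -- the edge joining them is `e`, which is not in `C`.
    v∉e : v ∉ ends e
    v∉e v∈e with other-end v∈e
    ... | u , u∈e , u≢v with ∈supp⁻ {S} (∈complete⁻ {W} e∈KW u∈e)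
    ...   | g , g∈S , u∈g = e∉C (subst (_∈ C)
      (edge-unique u≢v u∈g (∈star⁻ (p∩q⊆q C (star v) g∈S)) u∈e v∈e) (p∩q⊆p C (star v) g∈S))

    D₁ = (C ─ star v) ∪ ⁅ e ⁆

    ∈D₁⁻ : ∀ {x} → x ∈ D₁ → (x ∈ C × x ∉ star v) ⊎ x ≡ e
    ∈D₁⁻ x∈ with x∈p∪q⁻ (C ─ star v) ⁅ e ⁆ x∈
    ... | inj₁ x∈C = inj₁ (p─q⊆p C (star v) x∈C , x∈p─q⇒x∉q C (star v) x∈C)
    ... | inj₂ x≡e = inj₂ (x∈⁅y⁆⇒x≡y e x≡e)

    D₁-avoids-v : ∀ {x} → x ∈ D₁ → v ∉ ends x
    D₁-avoids-v x∈ v∈x with ∈D₁⁻ x∈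
    ... | inj₁ (_ , x∉star) = x∉star (∈star⁺ v∈x)
    ... | inj₂ refl         = v∉e v∈x

    D₁⊆ : ∀ {x X} → x ∈ D₁ → ends x ⊆ X → x ∈ complete (X - v)
    D₁⊆ {X = X} x∈ x⊆X = ∈complete⁺ {X - v} λ u∈x →
      x∈p∧x≢y⇒x∈p-y (x⊆X u∈x) λ { refl → D₁-avoids-v x∈ u∈x }

    2+∣D₁∣≡∣C∣ : 2 + ∣ D₁ ∣ ≡ ∣ C ∣
    2+∣D₁∣≡∣C∣ = begin
      2 + ∣ D₁ ∣                  ≡⟨ cong (2 +_) (∣p∪⁅x⁆∣≡suc∣p∣ (e∉C ∘ p─q⊆p C (star v))) ⟩
      3 + ∣ C ─ star v ∣          ≡⟨ +-comm 3 _ ⟩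
      ∣ C ─ star v ∣ + 3          ≡⟨ cong (∣ C ─ star v ∣ +_) (sym deg3) ⟩
      ∣ C ─ star v ∣ + ∣ S ∣      ≡⟨ ∣p─q∣+∣p∩q∣ C (star v) ⟩
      ∣ C ∣                       ∎
      where open ≡-Reasoning

    -- Three edges at `v` are lost and one is gained, while one vertex is lost: the edge count falls
    -- by 2 together with twice the vertex count, so tightness persists.
    D₁-dependent : ¬ Sparse D₁
    D₁-dependent = overloaded⇒dependent (supp C - v) (λ x∈ → D₁⊆ x∈ (within x∈))
      (s≤s⁻¹ (≤-trans (≤-trans (n≤1+n 3) (4≤∣supp∣ circuit)) (≤-reflexive (sym remove))))
      (≤-reflexive (+-cancelˡ-≡ 2 _ _ (begin
        2 + 2 * ∣ supp C - v ∣    ≡⟨ *-suc 2 ∣ supp C - v ∣ ⟨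
        2 * suc ∣ supp C - v ∣    ≡⟨ cong (2 *_) remove ⟩
        2 * ∣ supp C ∣            ≡⟨ circuit-tight circuit ⟨
        2 + ∣ C ∣                 ≡⟨ cong (2 +_) (sym 2+∣D₁∣≡∣C∣) ⟩
        2 + (2 + ∣ D₁ ∣)          ∎)))
      where
      open ≡-Reasoning
      remove : suc ∣ supp C - v ∣ ≡ ∣ supp C ∣
      remove = suc∣p-x∣≡∣p∣ v∈C
      within : ∀ {x} → x ∈ D₁ → ends x ⊆ supp C
      within x∈ with ∈D₁⁻ x∈
      ... | inj₁ (x∈C , _) = ∈supp⁺ x∈C
      ... | inj₂ refl      = e⊆C

    -- A circuit has at least six edges, but only three pairs of neighbours of v exist.
    escapes : ∀ {A} → Circuit A → A ⊆ D₁ → ∃[ f ] f ∈ A × f ∉ complete W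
    escapes {A} circuit-A A⊆D₁ with any? (λ f → (f ∈? A) ×-dec ¬? (f ∈? complete W))
    ... | yes found = found
    ... | no  none  = ⊥-elim (<⇒≱ (s≤s (s≤s (s≤s (s≤s z≤n))))
      (≤-trans (6≤∣circuit∣ circuit-A) (subst (∣ A ∣ ≤_) ∣K∣≡3 (p⊆q⇒∣p∣≤∣q∣ A⊆K))))
      where
      A⊆K : A ⊆ complete (W - v)
      A⊆K {f} f∈A = D₁⊆ (A⊆D₁ f∈A) (∈complete⁻ {W}
        (decidable-stable (f ∈? complete W) λ f∉ → none (f , f∈A , f∉)))
      ∣K∣≡3 : ∣ complete (W - v) ∣ ≡ 3
      ∣K∣≡3 = *-cancelʳ-≡ _ 3 2
        (trans (∣complete∣*2 (W - v)) (cong (λ n → n * (n ∸ 1)) ∣W-v∣≡3))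

    module _ {A} (circuit-A : Circuit A) (A⊆D₁ : A ⊆ D₁)
      {f} (f∈A : f ∈ A) (f∉KW : f ∉ complete W) where

      f≢e : f ≢ e
      f≢e refl = f∉KW e∈KW

      A-e⊆C : ∀ {x} → x ∈ A → x ≢ e → x ∈ C
      A-e⊆C x∈A x≢e with ∈D₁⁻ (A⊆D₁ x∈A)
      ... | inj₁ (x∈C , _) = x∈C
      ... | inj₂ x≡e       = ⊥-elim (x≢e x≡e)

      f∈C : f ∈ C
      f∈C = A-e⊆C f∈A f≢e

      D₂ = (C - f) ∪ ⁅ e ⁆

      ∈D₂⁻ : ∀ {x} → x ∈ D₂ → (x ∈ C × x ≢ f) ⊎ x ≡ e
      ∈D₂⁻ x∈ with x∈p∪q⁻ (C - f) ⁅ e ⁆ x∈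
      ... | inj₁ x∈C = inj₁ (p─q⊆p C ⁅ f ⁆ x∈C , x∈p-y⇒x≢y C x∈C)
      ... | inj₂ x≡e = inj₂ (x∈⁅y⁆⇒x≡y e x≡e)

      ∣D₂∣≡∣C∣ : ∣ D₂ ∣ ≡ ∣ C ∣
      ∣D₂∣≡∣C∣ = trans (∣p∪⁅x⁆∣≡suc∣p∣ (e∉C ∘ p─q⊆p C ⁅ f ⁆)) (suc∣p-x∣≡∣p∣ f∈C)

      D₂⊆supp : D₂ ⊆ complete (supp C)
      D₂⊆supp x∈ with ∈D₂⁻ x∈
      ... | inj₁ (x∈C , _) = ⊆complete-supp {C} x∈C
      ... | inj₂ refl      = ∈complete⁺ {supp C} e⊆C

      -- Exchanging `f` for `e` keeps both the edge count and a vertex set that holds all edges, so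
      -- that set stays overloaded.
      D₂-dependent : ¬ Sparse D₂
      D₂-dependent = overloaded⇒dependent (supp C) D₂⊆supp (2≤∣supp∣ (f , f∈C))
        (≤-reflexive (trans (sym (circuit-tight circuit)) (cong (2 +_) (sym ∣D₂∣≡∣C∣))))

      module _ {B} (circuit-B : Circuit B) (B⊆D₂ : B ⊆ D₂) where

        B-e⊆C : ∀ {x} → x ∈ B → x ≢ e → x ∈ C
        B-e⊆C x∈B x≢e with ∈D₂⁻ (B⊆D₂ x∈B)
        ... | inj₁ (x∈C , _) = x∈C
        ... | inj₂ x≡e       = ⊥-elim (x≢e x≡e)

        f∉B : f ∉ B
        f∉B f∈B with ∈D₂⁻ (B⊆D₂ f∈B)
        ... | inj₁ (_ , f≢f) = f≢f refl
        ... | inj₂ f≡e       = f≢e f≡e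

        -- Otherwise `A` is a dependent subset of `C`, so it contains all of `C`, including the
        -- edges at `v` that it avoids.
        e∈A : e ∈ A
        e∈A = decidable-stable (e ∈? A) λ e∉A → C⊈A (circuit-⊆-dependent circuit
          (λ x∈A → A-e⊆C x∈A λ { refl → e∉A x∈A }) (dependent circuit-A))
          where
          C⊈A : ¬ (C ⊆ A)
          C⊈A C⊆A with ∈supp⁻ {C} v∈C
          ... | g , g∈C , v∈g = D₁-avoids-v (A⊆D₁ (C⊆A g∈C)) v∈g

        -- Otherwise minimality forces `C` into `B`, although `f` is in `C` and not in `B`.
        e∈B : e ∈ B
        e∈B = decidable-stable (e ∈? B) λ e∉B → f∉B (circuit-⊆-dependent circuit
          (λ x∈B → B-e⊆C x∈B λ { refl → e∉B x∈B }) (dependent circuit-B) f∈C)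

        union⊆C : (A ∪ B) - e ⊆ C
        union⊆C x∈ with x∈p∪q⁻ A B (p─q⊆p (A ∪ B) ⁅ e ⁆ x∈)
        ... | inj₁ x∈A = A-e⊆C x∈A (x∈p-y⇒x≢y (A ∪ B) x∈)
        ... | inj₂ x∈B = B-e⊆C x∈B (x∈p-y⇒x≢y (A ∪ B) x∈)

        -- The edge `f` separates `A` from `B`, so elimination applies and the union without `e` is
        -- a dependent subset of `C`.
        C⊆union : C ⊆ (A ∪ B) - e
        C⊆union = circuit-⊆-dependent circuit union⊆C
          (circuit-elimination circuit-A circuit-B (λ A⊆B → f∉B (A⊆B f∈A)) e∈A e∈B)

        starB⊆S : B ∩ star v ⊆ S
        starB⊆S x∈ with x∈p∩q⁻ B (star v) x∈
        ... | x∈B , x∈v = x∈p∩q⁺ (B-e⊆C x∈B (λ { refl → v∉e (∈star⁻ x∈v) }) , x∈v)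

        star-in-B : ∀ {x} → x ∈ A ∪ B → x ∈ star v → x ∈ B
        star-in-B x∈ x∈v with x∈p∪q⁻ A B x∈
        ... | inj₁ x∈A = ⊥-elim (D₁-avoids-v (A⊆D₁ x∈A) (∈star⁻ x∈v))
        ... | inj₂ x∈B = x∈B

        -- `C` lies in `A ∪ B` and `A` has no edge at `v`, so `B` must supply the whole star.
        S⊆starB : S ⊆ B ∩ star v
        S⊆starB x∈ = let x∈C , x∈v = x∈p∩q⁻ C (star v) x∈ in
          x∈p∩q⁺ (star-in-B (p─q⊆p (A ∪ B) ⁅ e ⁆ (C⊆union x∈C)) x∈v , x∈v)

        -- The choice of `f` off `W` pays here: dropping it creates no new gap on `W`, while `e`
        -- fills one.
        missing-⊂ : D₂ ⊆ B → complete W ─ B ⊂ complete W ─ C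
        missing-⊂ D₂⊆B =
          (λ {x} x∈ → x∈p∧x∉q⇒x∈p─q (p─q⊆p (complete W) B x∈) λ x∈C →
            x∈p─q⇒x∉q (complete W) B x∈ (D₂⊆B (x∈p∪q⁺ (inj₁ (x∈p∧x≢y⇒x∈p-y x∈C
              λ { refl → f∉KW (p─q⊆p (complete W) B x∈) }))))) ,
          e , x∈p∧x∉q⇒x∈p─q e∈KW e∉C , λ e∈ → x∈p─q⇒x∉q (complete W) B e∈ e∈B

        B≤C : ∣ B ∣ ≤ ∣ C ∣
        B≤C = subst (∣ B ∣ ≤_) ∣D₂∣≡∣C∣ (p⊆q⇒∣p∣≤∣q∣ B⊆D₂)

        -- If `B` has as many edges as `C`, it exhausts `D₂` and the count of missing edges on `W`
        -- drops instead.
        smaller-B : ∣ B ∣ < ∣ C ∣ ⊎ ∣ B ∣ ≤ ∣ C ∣ × ∣ complete W ─ B ∣ < ∣ complete W ─ C ∣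
        smaller-B = map₂ (λ B≡C → B≤C , p⊂q⇒∣p∣<∣q∣ (missing-⊂
          (p⊆q∧∣q∣≤∣p∣⇒q⊆p B⊆D₂ (≤-reflexive (trans ∣D₂∣≡∣C∣ (sym B≡C))))))
          (m≤n⇒m<n∨m≡n B≤C)

        resolution : Resolution C v
        resolution = record
          { circuit-A = circuit-A
          ; circuit-B = circuit-B
          ; A≢B       = λ A≡B → f∉B (subst (f ∈_) A≡B f∈A)
          ; e∈A       = e∈A
          ; e∈B       = e∈B
          ; resultant = ⊆-antisym union⊆C C⊆union
          ; e⊆C       = e⊆C
          ; smaller-A = ≤-trans (s≤s (p⊆q⇒∣p∣≤∣q∣ A⊆D₁)) (≤-trans (n≤1+n _) (≤-reflexive 2+∣D₁∣≡∣C∣))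
          ; star-B    = ⊆-antisym starB⊆S S⊆starB
          ; smaller-B = smaller-B
          }

    opaque
      resolve : Resolution C v
      resolve =
        let A , A⊆D₁ , circuit-A = dependent⇒circuit D₁-dependent
            f , f∈A , f∉KW = escapes circuit-A A⊆D₁
            B , B⊆D₂ , circuit-B = dependent⇒circuit (D₂-dependent circuit-A A⊆D₁ f∈A f∉KW)
        in resolution circuit-A A⊆D₁ f∈A f∉KW circuit-B B⊆D₂

  -- Assembling the tree of combinatorial resultants.

  graph-CRes : ∀ {A B C e} → (A ∪ B) - e ≡ C → ends e ⊆ supp C →
    graph C ≡ CRes (graph A) (graph B) e
  graph-CRes {A} {B} {e = e} refl e⊆C = graph-≡ (⊆-antisym ⊆supp supp⊆′) refl
    where
    ⊆supp : supp ((A ∪ B) - e) ⊆ supp A ∪ supp B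
    ⊆supp v∈ with ∈supp⁻ {(A ∪ B) - e} v∈
    ... | g , g∈ , v∈g with x∈p∪q⁻ A B (p─q⊆p (A ∪ B) ⁅ e ⁆ g∈)
    ...   | inj₁ g∈A = x∈p∪q⁺ (inj₁ (∈supp⁺ g∈A v∈g))
    ...   | inj₂ g∈B = x∈p∪q⁺ (inj₂ (∈supp⁺ g∈B v∈g))

    covers : ∀ {g v} → g ∈ A ∪ B → v ∈ ends g → v ∈ supp ((A ∪ B) - e)
    covers {g} g∈ v∈g with g Fin.≟ e
    -- Deleting `e` isolates neither of its ends, since other edges of `C` cover them.
    ... | yes refl = e⊆C v∈g
    ... | no  g≢e  = ∈supp⁺ (x∈p∧x≢y⇒x∈p-y g∈ g≢e) v∈g

    supp⊆′ : supp A ∪ supp B ⊆ supp ((A ∪ B) - e)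
    supp⊆′ v∈ with x∈p∪q⁻ (supp A) (supp B) v∈
    ... | inj₁ v∈A = let g , g∈A , v∈g = ∈supp⁻ {A} v∈A in covers (x∈p∪q⁺ (inj₁ g∈A)) v∈g
    ... | inj₂ v∈B = let g , g∈B , v∈g = ∈supp⁻ {B} v∈B in covers (x∈p∪q⁺ (inj₂ g∈B)) v∈g

  ResultantTree : Graph → Set
  ResultantTree G = ∃[ t ] root t ≡ G × IsResultantTree t

  resultantNode : ∀ {G G₁ G₂} → IsRigidityCircuit G → IsCRes G G₁ G₂ →
    ResultantTree G₁ → ResultantTree G₂ → ResultantTree G
  resultantNode {G} rigid res (t₁ , refl , all₁ , K₁ , nodes₁) (t₂ , refl , all₂ , K₂ , nodes₂) =
    node t₁ G t₂ , refl , All.node all₁ rigid all₂ , All.node K₁ _ K₂ , res , nodes₁ , nodes₂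

  -- The fuel (n , m) bounds the lexicographic measure of the header.
  resultantTree : ∀ n m C v → Circuit C → v ∈ supp C → degree C v ≡ 3 →
    ∣ C ∣ ≤ n → ∣ complete (supp (C ∩ star v)) ─ C ∣ ≤ m → ResultantTree (graph C)
  resultantTree n m C v circuit v∈C deg3 C≤n missing≤m
    with any? (λ e → (e ∈? complete (supp (C ∩ star v))) ×-dec ¬? (e ∈? C))
  ... | no  none = leaf (graph C) , refl , All.leaf (graph-rigidityCircuit circuit) ,
    All.leaf (circuit-K₄ circuit (trans (∣supp-star∣ {C} v∈C) (cong suc deg3))
      (supp-mono (p∩q⊆p C (star v)))
      λ {e} e∈ → decidable-stable (e ∈? C) λ e∉C → none (e , e∈ , e∉C)) , _
  resultantTree zero _ C v circuit _ _ C≤0 _ | yes _ =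
    ⊥-elim (n≮0 (≤-trans (6≤∣circuit∣ circuit) C≤0))
  -- The edge `e` is itself missing, so the count cannot be zero.
  resultantTree (suc n) zero C v _ _ _ _ missing≤0 | yes (e , e∈KW , e∉C) =
    ⊥-elim (n≮0 (≤-trans (x∈p⇒∣p-x∣<∣p∣ (x∈p∧x∉q⇒x∈p─q e∈KW e∉C)) missing≤0))
  resultantTree (suc n) (suc m) C v circuit v∈C deg3 C≤n missing≤m | yes (e₀ , e∈KW , e∉C) =
    resultantNode (graph-rigidityCircuit circuit)
      (A≢B ∘ cong edges , e , e∈A , e∈B , graph-CRes resultant e⊆C)
      -- `A` need not contain `v`, so a new vertex of degree 3 is chosen; the first component drops,
      -- which lets the second restart at its actual value.
      (let u , u∈A , deg3-u = degree-3-vertex circuit-A in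
        resultantTree n _ A u circuit-A u∈A deg3-u (s≤s⁻¹ (≤-trans smaller-A C≤n)) ≤-refl)
      ([ (λ B<C → resultantTree n _ B v circuit-B v∈B deg3-B (s≤s⁻¹ (≤-trans B<C C≤n)) ≤-refl)
       -- Here the first component may stay the same; `star-B` shows that the second is measured on
       -- the same `W`.
       , (λ (B≤C , missing<) → resultantTree (suc n) m B v circuit-B v∈B deg3-B
           (≤-trans B≤C C≤n)
           (s≤s⁻¹ (subst (λ S → suc ∣ complete (supp S) ─ B ∣ ≤ suc m) (sym star-B)
             (≤-trans missing< missing≤m))))
       ]′ smaller-B)
    where
    open Resolution (Step.resolve circuit v∈C deg3 e∈KW e∉C)

    v∈B : v ∈ supp B
    v∈B with ∈supp⁻ {C} v∈C
    ... | g , g∈C , v∈g = ∈supp⁺ (p∩q⊆p B (star v)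
      (subst (g ∈_) (sym star-B) (x∈p∩q⁺ (g∈C , ∈star⁺ v∈g)))) v∈g

    deg3-B : degree B v ≡ 3
    deg3-B = trans (cong ∣_∣ star-B) deg3

theorem1 : (N : ℕ) → let open SubgraphsOfK N in
    (C : Graph) → IsRigidityCircuit C →
    ∃[ t ] root t ≡ C × IsResultantTree t
theorem1 N C (covered , isCircuit) =
  -- Without isolated vertices `C` is recovered from its edge set, and the fuel starts at the exact
  -- measure.
  subst ResultantTree (graph-edges covered)
    (resultantTree _ _ (edges C) _ circuit v∈C deg3 ≤-refl ≤-refl)
  where
  open SubgraphsOfK N
  open RigidityCircuits N
  circuit = isCircuit⇒circuit isCircuit
  v∈C = proj₁ (proj₂ (degree-3-vertex circuit))
  deg3 = proj₂ (proj₂ (degree-3-vertex circuit))
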